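{- For every $m \in \mathbb{N}$, the $m$-uniform hypergraph $\mathcal{H}_m = (V, \mathcal{E}_s \cup \mathcal{E}_p)$ defined below admits a realization with bottomless rectangles and horizontal strips: there is an injective map $\pi\colon V \to \mathbb{R}^2$ such that for every hyperedge $E$ of $\mathcal{H}_m$ there is a range $R \in \mathcal{R}_{\rm BL} \cup \mathcal{R}_{\rm HS}$ with $\pi(V) \cap R = \pi(E)$.
   Context: Construction of $\mathcal{H}_m$: first a rooted forest $F_m$ with $m^m$ trees is built, whose vertices are partitioned into "stages"; each stage $S$ carries a total order $<_S$, and all vertices of a stage have the same distance $j$ (the level of $S$) to the root of their tree; a stage on level $j \in \{0,\dots,m-1\}$ has $m^{m-j}$ vertices. Start with $m^m$ roots, which form the unique stage on level $0$, ordered in an arbitrary fixed way. Then, for every already defined stage $S$ on level $j < m-1$ and every subset $S' \subseteq S$ with $|S'| = m^{m-j-1}$, add a new stage $T(S')$ on level $j+1$ consisting of $m^{m-j-1}$ new vertices such that every vertex of $S'$ gets exactly one child from $T(S')$, and order $T(S')$ by $<_{T(S')}$ as their parents are ordered by $<_S$. $\mathcal{H}_m$ has vertex set $V = V(F_m)$; its hyperedges are the stage-hyperedges $\mathcal{E}_s$ (for every stage $S$, each set of $m$ consecutive vertices in $<_S$) and the path-hyperedges $\mathcal{E}_p$ (the vertex set of every root-to-leaf path in $F_m$). Bottomless rectangles: $\mathcal{R}_{\rm BL} = \{\{(x,y) : a_1 \leq x \leq a_2,\ y \leq b\} : a_1,a_2,b \in \mathbb{R}\}$; horizontal strips: $\mathcal{R}_{\rm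 HS} = \{\{(x,y) : b_1 \leq y \leq b_2\} : b_1,b_2 \in \mathbb{R}\}$. -}

module Defs where

open import Data.Fin.Base as Fin using (Fin; zero; suc; toℕ; fromℕ<; cast)
open import Data.Fin.Properties
  using (toℕ-injective; toℕ-fromℕ<; toℕ<n; cast-is-id; cast-trans)
open import Data.Fin.Subset using (Subset; inside; outside; ∣_∣; ⁅_⁆)
  renaming (_∈_ to _∈ₛ_; _⊆_ to _⊆ₛ_)
open import Data.Fin.Subset.Properties using (x∈⁅x⁆; ∣⁅x⁆∣≡1; ∣p∣≤n)
open import Data.List.Base as List using (List; []; _∷_; length; lookup)
open import Data.List.Membership.Propositional using () renaming (_∈_ to _∈ₗ_)
open import Data.List.Membership.Propositional.Properties using (∈-lookup)
open import Data.List.Relation.Unary.Any using (index)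
open import Data.List.Relation.Unary.Any.Properties using (lookup-index)
open import Data.List.Relation.Unary.Linked using (Linked; [-]; _∷_)
open import Data.Maybe.Relation.Unary.Any using (just) renaming (Any to AnyMaybe)
open import Data.Nat.Base
  using (ℕ; zero; suc; _+_; _∸_; _^_; _<_; z≤n; s≤s; NonZero; >-nonZero)
  renaming (_≤_ to _≤ⁿ_)
import Data.Nat.Properties as ℕₚ
open import Data.Product.Base using (Σ; ∃; ∃₂; _×_; _,_; proj₂)
open import Data.Rational.Base using (ℚ) renaming (_<_ to _<ℚ_)
open import Data.Sum.Base using (_⊎_; inj₁; inj₂)
open import Data.Vec.Base using ([]; _∷_; here; there)
open import Function.Bundles using (_⇔_)
open import Function.Definitions using (Injective)
open import Level using (0ℓ) renaming (suc to lsuc)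
open import Relation.Binary.Core using (Rel)
open import Relation.Binary.PropositionalEquality
  using (_≡_; refl; sym; trans; cong; subst)
open import Relation.Nullary using (¬_; contradiction)
open import Relation.Unary using (Pred; _∈_; _⊆_; _≐_; _∪_; _∩_; U)

------------------------------------------------------------------------
-- Real numbers, as two-sided Dedekind cuts

record ℝ : Set₁ where
  field
    lower upper : Pred ℚ 0ℓ
    inhabitedˡ  : ∃ λ q → q ∈ lower
    inhabitedᵘ  : ∃ λ q → q ∈ upper
    roundedˡ    : ∀ q → q ∈ lower ⇔ ∃ λ r → q <ℚ r × r ∈ lower
    roundedᵘ    : ∀ q → q ∈ upper ⇔ ∃ λ r → r <ℚ q × r ∈ upper
    disjoint    : ∀ q → ¬ (q ∈ lower × q ∈ upper)
    located     : ∀ q r → q <ℚ r → q ∈ lower ⊎ r ∈ upper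

open ℝ using (lower; upper)

infix 4 _≤_ _≈_ _≈²_

_≤_ : Rel ℝ 0ℓ
x ≤ y = lower x ⊆ lower y

-- Locatedness and disjointness make the lower cut determine the upper
-- one, so this is equality of reals.
_≈_ : Rel ℝ 0ℓ
x ≈ y = x ≤ y × y ≤ x

ℝ² : Set₁
ℝ² = ℝ × ℝ

_≈²_ : Rel ℝ² 0ℓ
(x , y) ≈² (x′ , y′) = x ≈ x′ × y ≈ y′

------------------------------------------------------------------------
-- Ranges

BottomlessRectangles : Pred (Pred ℝ² 0ℓ) (lsuc 0ℓ)
BottomlessRectangles R = ∃ λ a₁ → ∃₂ λ a₂ b →
  R ≐ (λ (x , y) → a₁ ≤ x × x ≤ a₂ × y ≤ b)

HorizontalStrips : Pred (Pred ℝ² 0ℓ) (lsuc 0ℓ)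
HorizontalStrips R = ∃₂ λ b₁ b₂ →
  R ≐ (λ (_ , y) → b₁ ≤ y × y ≤ b₂)

------------------------------------------------------------------------
-- Uniform hypergraphs and their realizations

HasSize : ∀ {A : Set} → Pred A 0ℓ → ℕ → Set
HasSize {A} E k = Σ (Fin k → A) λ f →
  Injective _≡_ _≡_ f × E ≐ (λ v → ∃ λ i → f i ≡ v)

record UniformHypergraph (k : ℕ) : Set₁ where
  field
    V       : Set
    ℰ       : Pred (Pred V 0ℓ) 0ℓ
    uniform : ∀ E → E ∈ ℰ → HasSize E k

image : ∀ {A : Set} → (A → ℝ²) → Pred A 0ℓ → Pred ℝ² 0ℓ
image π E p = ∃ λ v → v ∈ E × π v ≈² p

Realizable : ∀ {k} → UniformHypergraph k → Pred (Pred ℝ² 0ℓ) (lsuc 0ℓ) → Set₁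
Realizable H ℛ = Σ (V → ℝ²) λ π →
  Injective _≡_ _≈²_ π ×
  (∀ E → E ∈ ℰ → ∃ λ R → R ∈ ℛ × (image π U ∩ R) ≐ image π E)
  where open UniformHypergraph H

------------------------------------------------------------------------
-- Enumerating a subset of Fin n in increasing order

nth : ∀ {n} (p : Subset n) → Fin ∣ p ∣ → Fin n
nth (outside ∷ p) i       = suc (nth p i)
nth (inside  ∷ p) zero    = zero
nth (inside  ∷ p) (suc i) = suc (nth p i)

nth-mono-< : ∀ {n} (p : Subset n) {i k} → i Fin.< k → nth p i Fin.< nth p k
nth-mono-< (outside ∷ p)                 i<k       = s≤s (nth-mono-< p i<k)
nth-mono-< (inside  ∷ p) {zero}  {suc _} _         = s≤s z≤n
nth-mono-< (inside  ∷ p) {suc _} {suc _} (s≤s i<k) = s≤s (nth-mono-< p i<k)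

nth-∈ : ∀ {n} (p : Subset n) i → nth p i ∈ₛ p
nth-∈ (outside ∷ p) i       = there (nth-∈ p i)
nth-∈ (inside  ∷ p) zero    = here
nth-∈ (inside  ∷ p) (suc i) = there (nth-∈ p i)

nth-surjective : ∀ {n} (p : Subset n) {x} → x ∈ₛ p → ∃ λ i → nth p i ≡ x
nth-surjective (inside  ∷ p) here      = zero , refl
nth-surjective (inside  ∷ p) (there x∈p) with nth-surjective p x∈p
... | i , eq = suc i , cong suc eq
nth-surjective (outside ∷ p) (there x∈p) with nth-surjective p x∈p
... | i , eq = i , cong suc eq

extend : ∀ {n} (p : Subset n) {k} → ∣ p ∣ ≤ⁿ k → k ≤ⁿ n → ∃ λ q → p ⊆ₛ q × ∣ q ∣ ≡ k
extend []            {zero}  _         _         = [] , (λ ()) , refl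
extend (inside  ∷ p) {suc k} (s≤s p≤k) (s≤s k≤n) with extend p p≤k k≤n
... | q , p⊆q , eq = inside ∷ q , (λ { here → here ; (there x∈p) → there (p⊆q x∈p) }) , cong suc eq
extend {suc n} (outside ∷ p) {k} p≤k k≤1+n with ℕₚ.m≤n⇒m<n∨m≡n k≤1+n
... | inj₁ (s≤s k≤n) with extend p p≤k k≤n
...   | q , p⊆q , eq = outside ∷ q , (λ { (there x∈p) → there (p⊆q x∈p) }) , eq
extend {suc n} (outside ∷ p) {k} p≤k k≤1+n | inj₂ refl with extend p (∣p∣≤n p) ℕₚ.≤-refl
...   | q , p⊆q , eq = inside ∷ q , (λ { (there x∈p) → there (p⊆q x∈p) }) , cong suc eq

------------------------------------------------------------------------
-- The rooted forest and the hypergraph on it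

module Forest (m : ℕ) where

  size : ℕ → ℕ
  size j = m ^ (m ∸ j)

  -- The vertices of a stage S on level j are numbered by Fin (size j) in the
  -- order <_S, so a set S′ ⊆ S is a Subset (size j).  Levels are < m; for
  -- m = 0 there are no stages.
  data Stage : ℕ → Set where
    roots : 0 < m → Stage 0
    T     : ∀ {j} → suc j < m → (S : Stage j) (S′ : Subset (size j)) →
            ∣ S′ ∣ ≡ size (suc j) → Stage (suc j)

  record Vertex : Set where
    constructor vertex
    field
      {level}  : ℕ
      stage    : Stage level
      position : Fin (size level)

  open Vertex public

  -- Parent ⟶ child: the i-th vertex of T(S′) is the child of the i-th
  -- vertex of S′, so T(S′) is ordered as the parents are.
  data _⟶_ : Rel Vertex 0ℓ where
    edge : ∀ {j} (j<m : suc j < m) (S : Stage j) S′ (∣S′∣≡ : ∣ S′ ∣ ≡ size (suc j)) i →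
           vertex S (nth S′ (cast (sym ∣S′∣≡) i)) ⟶ vertex (T j<m S S′ ∣S′∣≡) i

  IsRoot IsLeaf : Pred Vertex 0ℓ
  IsRoot v = ∀ u → ¬ (u ⟶ v)
  IsLeaf v = ∀ w → ¬ (v ⟶ w)

  IsRootToLeafPath : Pred (List Vertex) 0ℓ
  IsRootToLeafPath vs =
    Linked _⟶_ vs × AnyMaybe IsRoot (List.head vs) × AnyMaybe IsLeaf (List.last vs)

  -- The m consecutive positions k, …, k + m - 1 of S.
  data Block {j} (S : Stage j) (k : ℕ) : Pred Vertex 0ℓ where
    block : ∀ {i} → k ≤ⁿ toℕ i → toℕ i < k + m → Block S k (vertex S i)

  StageHyperedges : Pred (Pred Vertex 0ℓ) 0ℓ
  StageHyperedges E = ∃₂ λ j (S : Stage j) → ∃ λ k → k + m ≤ⁿ size j × E ≐ Block S k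

  PathHyperedges : Pred (Pred Vertex 0ℓ) 0ℓ
  PathHyperedges E = ∃ λ vs → IsRootToLeafPath vs × E ≐ (_∈ₗ vs)

  ----------------------------------------------------------------------
  -- Uniformity

  stage-size : ∀ {j} (S : Stage j) {E : Pred Vertex 0ℓ} k →
               k + m ≤ⁿ size j → E ≐ Block S k → HasSize E m
  stage-size {j} S {E} k k+m≤ (E⊆ , ⊆E) = f , f-injective , (λ v∈E → hit (E⊆ v∈E)) , from
    where
    bound : (i : Fin m) → k + toℕ i < size j
    bound i = ℕₚ.<-≤-trans (ℕₚ.+-monoʳ-< k (toℕ<n i)) k+m≤

    f : Fin m → Vertex
    f i = vertex S (fromℕ< (bound i))

    pos-f : ∀ i → toℕ (position (f i)) ≡ k + toℕ i
    pos-f i = toℕ-fromℕ< (bound i)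

    f-injective : Injective _≡_ _≡_ f
    f-injective {i} {i′} eq = toℕ-injective (ℕₚ.+-cancelˡ-≡ k _ _
      (trans (sym (pos-f i)) (trans (cong (λ v → toℕ (position v)) eq) (pos-f i′))))

    hit : ∀ {v} → v ∈ Block S k → ∃ λ i → f i ≡ v
    hit (block {p} k≤p p<k+m) = fromℕ< p∸k<m , cong (vertex S) (toℕ-injective
      (trans (pos-f _) (trans (cong (k +_) (toℕ-fromℕ< p∸k<m)) (ℕₚ.m+[n∸m]≡n k≤p))))
      where
      p∸k<m : toℕ p ∸ k < m
      p∸k<m = ℕₚ.+-cancelˡ-< k _ _ (subst (_< k + m) (sym (ℕₚ.m+[n∸m]≡n k≤p)) p<k+m)

    from : ∀ {v} → (∃ λ i → f i ≡ v) → v ∈ E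
    from (i , refl) = ⊆E (block
      (subst (k ≤ⁿ_) (sym (pos-f i)) (ℕₚ.m≤m+n k _))
      (subst (_< k + m) (sym (pos-f i)) (ℕₚ.+-monoʳ-< k (toℕ<n i))))

  level<m : ∀ {j} → Stage j → j < m
  level<m (roots 0<m)   = 0<m
  level<m (T j<m _ _ _) = j<m

  root⇒level≡0 : ∀ {v} → IsRoot v → level v ≡ 0
  root⇒level≡0 {vertex (roots _) _}      _    = refl
  root⇒level≡0 {vertex (T j<m S S′ eq) i} root = contradiction (edge j<m S S′ eq i) (root _)

  child : ∀ {j} (S : Stage j) (x : Fin (size j)) → suc j < m → ∃ λ w → vertex S x ⟶ w
  child {j} S x j<m = go (extend ⁅ x ⁆
      (subst (_≤ⁿ size (suc j)) (sym (∣⁅x⁆∣≡1 x)) (ℕₚ.m^n>0 m (m ∸ suc j)))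
      (ℕₚ.^-monoʳ-≤ m (ℕₚ.∸-monoʳ-≤ m (ℕₚ.n≤1+n j))))
    where
    instance
      m≢0 : NonZero m
      m≢0 = >-nonZero (ℕₚ.≤-<-trans z≤n j<m)

    go : (∃ λ S′ → ⁅ x ⁆ ⊆ₛ S′ × ∣ S′ ∣ ≡ size (suc j)) → ∃ λ w → vertex S x ⟶ w
    go (S′ , x⊆S′ , eq) with nth-surjective S′ (x⊆S′ (x∈⁅x⁆ x))
    ... | i , refl = vertex (T j<m S S′ eq) (cast eq i) ,
      subst (λ y → vertex S (nth S′ y) ⟶ vertex (T j<m S S′ eq) (cast eq i))
        (trans (cast-trans eq (sym eq) i) (cast-is-id _ i))
        (edge j<m S S′ eq (cast eq i))

  leaf⇒level≡m-1 : ∀ {v} → IsLeaf v → suc (level v) ≡ m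
  leaf⇒level≡m-1 {vertex {j} S x} leaf with ℕₚ.m≤n⇒m<n∨m≡n (level<m S)
  ... | inj₂ eq  = eq
  ... | inj₁ j<m = contradiction (proj₂ (child S x j<m)) (leaf _)

  level-suc : ∀ {u v} → u ⟶ v → level v ≡ suc (level u)
  level-suc (edge _ _ _ _ _) = refl

  level-lookup : ∀ {v vs} → Linked _⟶_ (v ∷ vs) →
                 ∀ i → level (lookup (v ∷ vs) i) ≡ level v + toℕ i
  level-lookup _         zero    = sym (ℕₚ.+-identityʳ _)
  level-lookup (e ∷ es) (suc i) = trans (level-lookup es i)
    (trans (cong (_+ toℕ i) (level-suc e)) (sym (ℕₚ.+-suc _ (toℕ i))))

  path-length : ∀ {v vs} → Linked _⟶_ (v ∷ vs) → AnyMaybe IsLeaf (List.last (v ∷ vs)) →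
                level v + length (v ∷ vs) ≡ m
  path-length [-]      (just leaf) = trans (ℕₚ.+-comm _ 1) (leaf⇒level≡m-1 leaf)
  path-length (e ∷ es) leaf        = trans (ℕₚ.+-suc _ _)
    (trans (cong (_+ _) (sym (level-suc e))) (path-length es leaf))

  path-size : ∀ {vs} {E : Pred Vertex 0ℓ} → IsRootToLeafPath vs → E ≐ (_∈ₗ vs) → HasSize E m
  path-size {v ∷ vs} {E} (linked , just root , leaf) (E⊆ , ⊆E) =
    subst (HasSize E) (trans (cong (_+ _) (sym (root⇒level≡0 root))) (path-length linked leaf))
      (lookup (v ∷ vs) , injective
      , (λ u∈E → let u∈vs = E⊆ u∈E in index u∈vs , sym (lookup-index u∈vs))
      , λ { (i , refl) → ⊆E (∈-lookup i) })
    where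
    injective : Injective _≡_ _≡_ (lookup (v ∷ vs))
    injective {i} {k} eq = toℕ-injective (ℕₚ.+-cancelˡ-≡ (level v) _ _
      (trans (sym (level-lookup linked i)) (trans (cong level eq) (level-lookup linked k))))

  hyperedge-size : ∀ E → E ∈ StageHyperedges ∪ PathHyperedges → HasSize E m
  hyperedge-size E (inj₁ (_ , S , k , k+m≤ , E≐)) = stage-size S k k+m≤ E≐
  hyperedge-size E (inj₂ (_ , path , E≐))         = path-size path E≐

ℋ : ∀ m → UniformHypergraph m
ℋ m = record
  { V       = Vertex
  ; ℰ       = StageHyperedges ∪ PathHyperedges
  ; uniform = hyperedge-size
  }
  where open Forest m

{-# OPTIONS --safe #-}

-- Number the stages in preorder: a stage first, then, for each child stage in
-- turn, everything descending from it.  Let y grow with the number of the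
-- stage and, within a stage, with the position, so that stages, and hence
-- their blocks, are cut out by strips.  Let x be a preorder of the forest in
-- which the children of a vertex appear in the opposite order of their stages.
-- A path from a root r to a leaf l is then the part with y ≤ y(l) of the slab
-- x(r) ≤ x ≤ x(l): a vertex of this slab off the path branches off it at some
-- vertex towards a child to the left of the path, i.e. towards a later stage,
-- all of whose descendants lie above l.
--
-- Both preorders are realized by numerals in base suc digits: every vertex and
-- every stage owns an interval, whose first point is the vertex or stage
-- itself, and its children own disjoint subintervals of 1 / suc digits of the
-- length, at the nonzero digits.

module Submission where

open import Defs
open import Data.Fin.Base as Fin using (Fin; toℕ; cast; funToFin; finToFun)
open import Data.Fin.Properties
  using (toℕ-injective; toℕ<n; toℕ-cast; finToFun-funToFin; 2↔Bool)
import Data.Fin.Properties as Finₚ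
open import Data.Fin.Subset using (Subset)
open import Data.Integer.Base as ℤ using ()
import Data.Integer.Properties as ℤₚ
open import Data.List.Base as List using (List; []; _∷_)
open import Data.List.Membership.Propositional using () renaming (_∈_ to _∈ₗ_)
open import Data.List.Relation.Unary.Any using (here; there)
open import Data.List.Relation.Unary.Linked using (Linked; [-]; _∷_)
open import Data.Maybe.Relation.Unary.Any using (just) renaming (Any to AnyMaybe)
open import Data.Nat.Base
  using (ℕ; suc; pred; _+_; _*_; _∸_; _^_; _<_; z≤n; s≤s; NonZero; >-nonZero)
  renaming (_≤_ to _≤ⁿ_)
import Data.Nat.Properties as ℕₚ
open import Data.Product.Base using (∃; ∃₂; _×_; _,_; proj₁; proj₂; map; swap)
open import Data.Rational.Base using (ℚ; *<*) renaming (_<_ to _<ℚ_)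
open import Data.Rational.Literals using (fromℤ)
import Data.Rational.Properties as ℚₚ
open import Data.Sum.Base using (_⊎_; inj₁; inj₂)
open import Data.Vec.Base using (lookup; tabulate)
open import Data.Vec.Properties using (tabulate∘lookup; tabulate-cong)
open import Function.Base using (_∘_)
open import Function.Bundles using (mk⇔; Inverse)
open import Function.Definitions using (Injective)
open import Level using (0ℓ)
open import Relation.Binary.Construct.Closure.ReflexiveTransitive
  using (Star; ε; _◅_; _◅◅_; fold; gmap)
open import Relation.Binary.Core using (Rel)
open import Relation.Binary.Definitions using (tri<; tri≈; tri>)
open import Relation.Binary.PropositionalEquality
  using (_≡_; refl; sym; trans; cong; subst; subst₂)
open import Relation.Nullary using (yes; no; contradiction)
open import Relation.Unary using (Pred; _∈_; _≐_; _∪_; _∩_; U)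

-- Natural numbers as real numbers

fromℤ-mono-< : ∀ {i j} → i ℤ.< j → fromℤ i <ℚ fromℤ j
fromℤ-mono-< {i} {j} i<j =
  *<* (subst₂ ℤ._<_ (sym (ℤₚ.*-identityʳ i)) (sym (ℤₚ.*-identityʳ j)) i<j)

real : ℕ → ℝ
real n = record
  { lower      = _<ℚ q
  ; upper      = q <ℚ_
  ; inhabitedˡ = fromℤ ℤ.-1ℤ , fromℤ-mono-< ℤ.-<+
  ; inhabitedᵘ = fromℤ (ℤ.+ suc n) , fromℤ-mono-< (ℤ.+<+ ℕₚ.≤-refl)
  ; roundedˡ   = λ _ → mk⇔ ℚₚ.<-dense (λ (_ , p<r , r<q) → ℚₚ.<-trans p<r r<q)
  ; roundedᵘ   = λ _ → mk⇔
      (λ q<p → let r , q<r , r<p = ℚₚ.<-dense q<p in r , r<p , q<r)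
      (λ (_ , r<p , q<r) → ℚₚ.<-trans q<r r<p)
  ; disjoint   = λ _ (p<q , q<p) → ℚₚ.<-asym p<q q<p
  ; located    = located
  }
  where
  q : ℚ
  q = fromℤ (ℤ.+ n)

  located : ∀ p r → p <ℚ r → p <ℚ q ⊎ q <ℚ r
  located p r p<r with p ℚₚ.<? q
  ... | yes p<q = inj₁ p<q
  ... | no  p≮q = inj₂ (ℚₚ.≤-<-trans (ℚₚ.≮⇒≥ p≮q) p<r)

real-mono-≤ : ∀ {m n} → m ≤ⁿ n → real m ≤ real n
real-mono-≤ m≤n p<m with ℕₚ.m≤n⇒m<n∨m≡n m≤n
... | inj₁ m<n  = ℚₚ.<-trans p<m (fromℤ-mono-< (ℤ.+<+ m<n))
... | inj₂ refl = p<m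

real-cancel-≤ : ∀ {m n} → real m ≤ real n → m ≤ⁿ n
real-cancel-≤ m≤n = ℕₚ.≮⇒≥ λ n<m → ℚₚ.<-irrefl refl (m≤n (fromℤ-mono-< (ℤ.+<+ n<m)))

real-injective : ∀ {m n} → real m ≈ real n → m ≡ n
real-injective (m≤n , n≤m) = ℕₚ.≤-antisym (real-cancel-≤ m≤n) (real-cancel-≤ n≤m)

-- Points count as equal only up to `≈²`, so a vertex stands for every point equal to its own. For a
-- range respecting `≈²`, membership can then be tested at `π v`.
image-∩ : ∀ {A : Set} (π : A → ℝ²) (R : Pred ℝ² 0ℓ) {E : Pred A 0ℓ} →
          (∀ {p q} → p ≈² q → p ∈ R → q ∈ R) → E ≐ (λ v → π v ∈ R) →
          (image π U ∩ R) ≐ image π E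
image-∩ π R {E} resp (E⊆R , R⊆E) =
  (λ {p} → λ { ((v , _ , πv≈p) , p∈R) → v , R⊆E (resp {p} {π v} (map swap swap πv≈p) p∈R) , πv≈p }) ,
  (λ {p} → λ { (v , v∈E , πv≈p) → (v , _ , πv≈p) , resp {π v} {p} πv≈p (E⊆R v∈E) })

-- Subsets of Fin n

-- A subset is read as the binary word of its indicator function, which turns it into a number
-- usable as a digit.
encode : ∀ {n} → Subset n → Fin (2 ^ n)
encode p = funToFin (Inverse.from 2↔Bool ∘ lookup p)

decode : ∀ {n} → Fin (2 ^ n) → Subset n
decode k = tabulate (Inverse.to 2↔Bool ∘ finToFun k)

decode-encode : ∀ {n} (p : Subset n) → decode (encode p) ≡ p
decode-encode p = trans
  (tabulate-cong λ i → trans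
    (cong (Inverse.to 2↔Bool) (finToFun-funToFin (Inverse.from 2↔Bool ∘ lookup p) i))
    (Inverse.strictlyInverseˡ 2↔Bool (lookup p i)))
  (tabulate∘lookup p)

code : ∀ {n} → Subset n → ℕ
code p = toℕ (encode p)

code<2^n : ∀ {n} (p : Subset n) → code p < 2 ^ n
code<2^n p = toℕ<n (encode p)

code-injective : ∀ {n} {p q : Subset n} → code p ≡ code q → p ≡ q
code-injective {p = p} {q} eq = trans (sym (decode-encode p))
  (trans (cong decode (toℕ-injective eq)) (decode-encode q))

cast-injective : ∀ {m n} .(eq : m ≡ n) → Injective _≡_ _≡_ (cast eq)
cast-injective eq {i} {k} ci≡ck = toℕ-injective
  (trans (sym (toℕ-cast eq i)) (trans (cong toℕ ci≡ck) (toℕ-cast eq k)))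

nth-injective : ∀ {n} (p : Subset n) → Injective _≡_ _≡_ (nth p)
nth-injective p {i} {k} eq with Finₚ.<-cmp i k
... | tri< i<k _ _ = contradiction (nth-mono-< p i<k) (Finₚ.<-irrefl eq)
... | tri≈ _ i≡k _ = i≡k
... | tri> _ _ k<i = contradiction (nth-mono-< p k<i) (Finₚ.<-irrefl (sym eq))

-- Intervals of natural numbers, given by start and length

Interval : Set
Interval = ℕ × ℕ

infix 4 _⊑_ _≪_

_⊑_ _≪_ : Rel Interval 0ℓ
(a , w) ⊑ (b , w′) = b ≤ⁿ a × a + w ≤ⁿ b + w′
(a , w) ≪ (b , _)  = a + w ≤ⁿ b

⊑-refl : ∀ {I} → I ⊑ I
⊑-refl = ℕₚ.≤-refl , ℕₚ.≤-refl

⊑-trans : ∀ {I J K} → I ⊑ J → J ⊑ K → I ⊑ K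
⊑-trans (b≤a , a≤b) (c≤b , b≤c) = ℕₚ.≤-trans c≤b b≤a , ℕₚ.≤-trans a≤b b≤c

-- Carries the order of two sibling intervals over to arbitrary descendants.
≪-resp-⊑ : ∀ {I I′ J J′} → I′ ⊑ I → J′ ⊑ J → I ≪ J → I′ ≪ J′
≪-resp-⊑ (_ , I′≤I) (J≤J′ , _) I≪J = ℕₚ.≤-trans I′≤I (ℕₚ.≤-trans I≪J J≤J′)

cell : ℕ → ℕ → ℕ → Interval
cell a w d = a + d * w , w

cell-≪ : ∀ a w {d d′} → d < d′ → cell a w d ≪ cell a w d′
cell-≪ a w {d} {d′} d<d′ = begin
  a + d * w + w     ≡⟨ ℕₚ.+-assoc a (d * w) w ⟩
  a + (d * w + w)   ≡⟨ cong (a +_) (ℕₚ.+-comm (d * w) w) ⟩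
  a + suc d * w     ≤⟨ ℕₚ.+-monoʳ-≤ a (ℕₚ.*-monoˡ-≤ w d<d′) ⟩
  a + d′ * w        ∎
  where open ℕₚ.≤-Reasoning

cell-⊑ : ∀ a w {d b} → d < b → cell a w d ⊑ (a , b * w)
cell-⊑ a w d<b = ℕₚ.m≤m+n a _ , cell-≪ a w d<b

module Realization (m : ℕ) where

  open Forest m

  -- No stage has more than `m ^ m` vertices, so this exceeds the codes of the subsets of every
  -- stage, and one base serves all levels.
  digits : ℕ
  digits = 2 ^ (m ^ m)

  width : ℕ → ℕ
  width j = suc digits ^ (m ∸ j)

  width>0 : ∀ j → 0 < width j
  width>0 j = ℕₚ.m^n>0 (suc digits) (m ∸ j)

  width-suc : ∀ {j} → suc j < m → width j ≡ suc digits * width (suc j)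
  width-suc j<m = cong (suc digits ^_) (ℕₚ.+-∸-assoc 1 (ℕₚ.<⇒≤ j<m))

  size≤ : ∀ {j} → Stage j → size j ≤ⁿ m ^ m
  size≤ {j} S = ℕₚ.^-monoʳ-≤ m ⦃ >-nonZero (ℕₚ.≤-<-trans z≤n (level<m S)) ⦄ (ℕₚ.m∸n≤m m j)

  code<digits : ∀ {j} → Stage j → (S′ : Subset (size j)) → code S′ < digits
  code<digits S S′ = ℕₚ.<-≤-trans (code<2^n S′) (ℕₚ.^-monoʳ-≤ 2 (size≤ S))

  ≪⇒< : ∀ {a b} j → a + width j ≤ⁿ b → a < b
  ≪⇒< {a} j = ℕₚ.<-≤-trans (ℕₚ.m<m+n a (width>0 j))

  -- The preorder of the stages

  Node : Set
  Node = ∃ Stage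

  -- The `suc` leaves the digit zero to the stage itself, so every child starts strictly after its
  -- parent.
  start : ∀ {j} → Stage j → ℕ
  start (roots _)          = 0
  start (T {j} _ S S′ _) = start S + suc (code S′) * width (suc j)

  stageSpan : Node → Interval
  stageSpan (j , S) = start S , width j

  data _⇒_ : Rel Node 0ℓ where
    stage-edge : ∀ {j} (j<m : suc j < m) (S : Stage j) S′ ∣S′∣≡ →
            (j , S) ⇒ (suc j , T j<m S S′ ∣S′∣≡)

  start-< : ∀ {s t} → s ⇒ t → start (proj₂ s) < start (proj₂ t)
  start-< (stage-edge {j} _ S S′ _) =
    ℕₚ.m<m+n (start S) (ℕₚ.<-≤-trans (width>0 (suc j)) (ℕₚ.m≤m+n _ _))

  stageSpan-step : ∀ {s t} → s ⇒ t → stageSpan t ⊑ stageSpan s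
  stageSpan-step (stage-edge {j} j<m S S′ _) rewrite width-suc j<m =
    cell-⊑ (start S) (width (suc j)) (s≤s (code<digits S S′))

  stageSpan-⊑ : ∀ {s t} → Star _⇒_ s t → stageSpan t ⊑ stageSpan s
  stageSpan-⊑ = fold (λ s t → stageSpan t ⊑ stageSpan s)
    (λ e t⊑u → ⊑-trans t⊑u (stageSpan-step e)) ⊑-refl

  stage-ancestor : ∀ {j} (S : Stage j) → ∃ λ 0<m → Star _⇒_ (0 , roots 0<m) (j , S)
  stage-ancestor (roots 0<m)         = 0<m , ε
  stage-ancestor (T j<m S S′ eq) with stage-ancestor S
  ... | 0<m , es = 0<m , es ◅◅ stage-edge j<m S S′ eq ◅ ε

  -- The two chains are followed from `s` to where they part. Distinct digits there put everything
  -- further down into disjoint intervals; if one chain ends first, the other still moves strictly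
  -- to the right.
  start-injective-below : ∀ {s t t′} → Star _⇒_ s t → Star _⇒_ s t′ →
                          start (proj₂ t) ≡ start (proj₂ t′) → t ≡ t′
  start-injective-below ε        ε         _  = refl
  start-injective-below ε        (e ◅ es) eq =
    contradiction eq (ℕₚ.<⇒≢ (ℕₚ.<-≤-trans (start-< e) (proj₁ (stageSpan-⊑ es))))
  start-injective-below (e ◅ es) ε        eq =
    contradiction (sym eq) (ℕₚ.<⇒≢ (ℕₚ.<-≤-trans (start-< e) (proj₁ (stageSpan-⊑ es))))
  start-injective-below {t = j₁ , _} {j₂ , _}
    (stage-edge {j} j<m S S′ e ◅ es) (stage-edge j<m′ _ S″ e′ ◅ es′) eq
    with ℕₚ.<-cmp (code S′) (code S″)
  ... | tri< c<c′ _ _ = contradiction eq (ℕₚ.<⇒≢ (≪⇒< j₁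
          (≪-resp-⊑ (stageSpan-⊑ es) (stageSpan-⊑ es′)
            (cell-≪ (start S) (width (suc j)) (s≤s c<c′)))))
  ... | tri> _ _ c′<c = contradiction (sym eq) (ℕₚ.<⇒≢ (≪⇒< j₂
          (≪-resp-⊑ (stageSpan-⊑ es′) (stageSpan-⊑ es)
            (cell-≪ (start S) (width (suc j)) (s≤s c′<c)))))
  -- The other arguments of `T` are proofs, equal by irrelevance, so equal codes mean the same child
  -- stage.
  ... | tri≈ _ c≡c′ _ with code-injective {p = S′} {S″} c≡c′
  ...   | refl with ℕₚ.<-irrelevant j<m j<m′ | ℕₚ.≡-irrelevant e e′
  ...     | refl | refl = start-injective-below es es′ eq

  start-injective : ∀ {s t : Node} → start (proj₂ s) ≡ start (proj₂ t) → s ≡ t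
  start-injective {_ , S} {_ , S′} eq with stage-ancestor S | stage-ancestor S′
  ... | 0<m , es | 0<m′ , es′ with ℕₚ.<-irrelevant 0<m 0<m′
  ...   | refl = start-injective-below es es′ eq

  -- Ordinates of the vertices

  node : Vertex → Node
  node v = level v , stage v

  -- The factor `m ^ m` is at least the size of any stage, so positions never run into the ordinates
  -- of the next stage.
  y : Vertex → ℕ
  y v = start (stage v) * m ^ m + toℕ (position v)

  position< : ∀ v → toℕ (position v) < m ^ m
  position< v = ℕₚ.<-≤-trans (toℕ<n (position v)) (size≤ (stage v))

  y-< : ∀ v w → start (stage v) < start (stage w) → y v < y w
  y-< v w s<t = begin-strict
    start (stage v) * m ^ m + toℕ (position v) <⟨ ℕₚ.+-monoʳ-< _ (position< v) ⟩
    start (stage v) * m ^ m + m ^ m            ≡⟨ ℕₚ.+-comm _ (m ^ m) ⟩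
    suc (start (stage v)) * m ^ m              ≤⟨ ℕₚ.*-monoˡ-≤ (m ^ m) s<t ⟩
    start (stage w) * m ^ m                    ≤⟨ ℕₚ.m≤m+n _ _ ⟩
    y w                                        ∎
    where open ℕₚ.≤-Reasoning hiding (start)

  y-injective : ∀ {v w} → y v ≡ y w → v ≡ w
  y-injective {v} {w} eq with ℕₚ.<-cmp (start (stage v)) (start (stage w))
  ... | tri< s<t _ _ = contradiction eq (ℕₚ.<⇒≢ (y-< v w s<t))
  ... | tri> _ _ t<s = contradiction (sym eq) (ℕₚ.<⇒≢ (y-< w v t<s))
  ... | tri≈ _ s≡t _ with start-injective {node v} {node w} s≡t
  ...   | refl = cong (vertex (stage v)) (toℕ-injective (ℕₚ.+-cancelˡ-≡ _ _ _ eq))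

  -- The preorder of the vertices

  -- Subtracting the code from `digits` reverses the order used by `start`; as codes stay below
  -- `digits`, the result is again a nonzero digit.
  abscissa : ∀ {j} → Stage j → Fin (size j) → ℕ
  abscissa (roots _)           i = toℕ i * width 0
  abscissa (T {j} _ S S′ eq) i =
    abscissa S (nth S′ (cast (sym eq) i)) + (digits ∸ code S′) * width (suc j)

  x : Vertex → ℕ
  x v = abscissa (stage v) (position v)

  span : Vertex → Interval
  span v = x v , width (level v)

  span-step : ∀ {u v} → u ⟶ v → span v ⊑ span u
  span-step (edge {j} j<m S S′ _ _) rewrite width-suc j<m =
    cell-⊑ _ (width (suc j)) (s≤s (ℕₚ.m∸n≤m digits (code S′)))

  span-⊑ : ∀ {v w} → Star _⟶_ v w → span w ⊑ span v
  span-⊑ = fold (λ v w → span w ⊑ span v) (λ e w⊑u → ⊑-trans w⊑u (span-step e)) ⊑-refl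

  ⟶⇒⇒ : ∀ {u v} → u ⟶ v → node u ⇒ node v
  ⟶⇒⇒ (edge j<m S S′ eq _) = stage-edge j<m S S′ eq

  nodeSpan-⊑ : ∀ {v w} → Star _⟶_ v w → stageSpan (node w) ⊑ stageSpan (node v)
  nodeSpan-⊑ = stageSpan-⊑ ∘ gmap node ⟶⇒⇒

  y-mono : ∀ {v w} → Star _⟶_ v w → y v ≤ⁿ y w
  y-mono ε                = ℕₚ.≤-refl
  y-mono {v} {w} (e ◅ es) = ℕₚ.<⇒≤ (y-< v w
    (ℕₚ.<-≤-trans (start-< (⟶⇒⇒ e)) (proj₁ (nodeSpan-⊑ es))))

  -- An edge from u with the index u a variable, so that two edges from the
  -- same vertex can be matched simultaneously.
  data Child (u : Vertex) : Pred Vertex 0ℓ where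
    via : ∀ j<m S′ ∣S′∣≡ i → position u ≡ nth S′ (cast (sym ∣S′∣≡) i) →
            Child u (vertex (T j<m (stage u) S′ ∣S′∣≡) i)

  ⟶⇒Child : ∀ {u v} → u ⟶ v → Child u v
  ⟶⇒Child (edge j<m S S′ eq i) = via j<m S′ eq i refl

  span-child : ∀ u j<m S′ ∣S′∣≡ i → position u ≡ nth S′ (cast (sym ∣S′∣≡) i) →
               cell (x u) (width (suc (level u))) (digits ∸ code S′) ≡
               span (vertex (T j<m (stage u) S′ ∣S′∣≡) i)
  span-child u _ S′ _ _ = cong λ p → cell (abscissa (stage u) p) _ (digits ∸ code S′)

  -- Digits of children are ordered oppositely in the two preorders, so one of them puts `v` before
  -- `w`. Equal codes mean a common stage, in which `u` has only one child because `nth` is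
  -- injective.
  siblings : ∀ {u v w} → u ⟶ v → u ⟶ w →
             v ≡ w ⊎ stageSpan (node v) ≪ stageSpan (node w) ⊎ span v ≪ span w
  siblings {u} u⟶v u⟶w with ⟶⇒Child u⟶v | ⟶⇒Child u⟶w
  ... | via j<m S′ e i p | via j<m′ S″ e′ i′ p′ with ℕₚ.<-cmp (code S′) (code S″)
  ...   | tri< c<c′ _ _ = inj₂ (inj₁ (cell-≪ (start (stage u)) _ (s≤s c<c′)))
  ...   | tri> _ _ c′<c = inj₂ (inj₂ (subst₂ _≪_ (span-child u j<m S′ e i p)
            (span-child u j<m′ S″ e′ i′ p′)
            (cell-≪ (x u) (width (suc (level u)))
              (ℕₚ.∸-monoʳ-< c′<c (ℕₚ.<⇒≤ (code<digits (stage u) S′))))))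
  ...   | tri≈ _ c≡c′ _ with code-injective {p = S′} {S″} c≡c′
  ...     | refl with ℕₚ.<-irrelevant j<m j<m′ | ℕₚ.≡-irrelevant e e′
  ...       | refl | refl = inj₁ (cong (vertex _)
                (cast-injective (sym e) (nth-injective S′ (trans (sym p) p′))))

  ancestor : ∀ {j} (S : Stage j) i →
             ∃₂ λ 0<m r → Star _⟶_ (vertex (roots 0<m) r) (vertex S i)
  ancestor (roots 0<m)     i = 0<m , i , ε
  ancestor (T j<m S S′ eq) i with ancestor S (nth S′ (cast (sym eq) i))
  ... | 0<m , r , es = 0<m , r , es ◅◅ edge j<m S S′ eq i ◅ ε

  -- Paths

  endOf : Vertex → List Vertex → Vertex
  endOf v []       = v
  endOf _ (u ∷ us) = endOf u us

  last⇒endOf : ∀ {P : Pred Vertex 0ℓ} v vs → AnyMaybe P (List.last (v ∷ vs)) → P (endOf v vs)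
  last⇒endOf v []       (just Pv) = Pv
  last⇒endOf _ (u ∷ us) any       = last⇒endOf u us any

  to-end : ∀ {v vs} → Linked _⟶_ (v ∷ vs) → Star _⟶_ v (endOf v vs)
  to-end [-]      = ε
  to-end (e ∷ es) = e ◅ to-end es

  through : ∀ {v vs w} → Linked _⟶_ (v ∷ vs) → w ∈ₗ v ∷ vs →
            Star _⟶_ v w × Star _⟶_ w (endOf v vs)
  through es       (here refl)  = ε , to-end es
  through (e ∷ es) (there w∈us) with through es w∈us
  ... | v⟶*w , w⟶*l = e ◅ v⟶*w , w⟶*l

  descendant-on-path : ∀ {v vs w} → Linked _⟶_ (v ∷ vs) → IsLeaf (endOf v vs) → Star _⟶_ v w →
                       x w ≤ⁿ x (endOf v vs) → y w ≤ⁿ y (endOf v vs) → w ∈ₗ v ∷ vs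
  descendant-on-path _        _    ε        _   _   = here refl
  descendant-on-path [-]      leaf (f ◅ _)  _   _   = contradiction f (leaf _)
  descendant-on-path {vs = u ∷ us} {w} (e ∷ es) leaf (f ◅ fs) x≤ y≤ with siblings e f
  ... | inj₁ refl       = there (descendant-on-path es leaf fs x≤ y≤)
  -- The branch to `w` leaves to the left, into a later stage, and everything there lies above the
  -- leaf.
  ... | inj₂ (inj₁ u≪t) = contradiction y≤ (ℕₚ.<⇒≱ (y-< (endOf u us) w
          (≪⇒< (level (endOf u us)) (≪-resp-⊑ (nodeSpan-⊑ (to-end es)) (nodeSpan-⊑ fs) u≪t))))
  -- The branch leaves to the right, so `w` violates the right bound.
  ... | inj₂ (inj₂ u≪t) = contradiction x≤ (ℕₚ.<⇒≱
          (≪⇒< (level (endOf u us)) (≪-resp-⊑ (span-⊑ (to-end es)) (span-⊑ fs) u≪t)))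

  -- The side bounds single out the tree: trees of later roots lie to the right of the end of the
  -- path, trees of earlier roots to the left of `v`.
  on-path : ∀ {v vs w} → Linked _⟶_ (v ∷ vs) → IsRoot v → IsLeaf (endOf v vs) →
            x v ≤ⁿ x w → x w ≤ⁿ x (endOf v vs) → y w ≤ⁿ y (endOf v vs) → w ∈ₗ v ∷ vs
  on-path {vertex (T j<m S S′ eq) i} _ root _ _ _ _ = contradiction (edge j<m S S′ eq i) (root _)
  on-path {vertex (roots 0<m) i} {vs} {w} es root leaf ≤x x≤ y≤
    with ancestor (stage w) (position w)
  ... | 0<m′ , i′ , fs with ℕₚ.<-irrelevant 0<m 0<m′ | Finₚ.<-cmp i i′
  ...   | refl | tri≈ _ refl _ = descendant-on-path es leaf fs x≤ y≤
  ...   | refl | tri< i<i′ _ _ = contradiction x≤ (ℕₚ.<⇒≱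
            (≪⇒< (level (endOf _ vs))
              (≪-resp-⊑ (span-⊑ (to-end es)) (span-⊑ fs) (cell-≪ 0 (width 0) i<i′))))
  ...   | refl | tri> _ _ i′<i = contradiction ≤x (ℕₚ.<⇒≱
            (≪⇒< (level w)
              (≪-resp-⊑ (span-⊑ fs) (span-⊑ {vertex (roots 0<m) i} ε) (cell-≪ 0 (width 0) i′<i))))

  -- The embedding and the ranges for the hyperedges

  π : Vertex → ℝ²
  π v = real (x v) , real (y v)

  π-injective : Injective _≡_ _≈²_ π
  π-injective (_ , y≈) = y-injective (real-injective y≈)

  Realized : Pred Vertex 0ℓ → Set₁
  Realized E = ∃ λ R → R ∈ BottomlessRectangles ∪ HorizontalStrips × (image π U ∩ R) ≐ image π E

  realize-strip : ∀ {E} b₁ b₂ → E ≐ (λ v → b₁ ≤ⁿ y v × y v ≤ⁿ b₂) → Realized E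
  realize-strip b₁ b₂ (E⊆ , ⊆E) =
    R , inj₂ (real b₁ , real b₂ , (λ r → r) , (λ r → r)) , image-∩ π R
      (λ (_ , q≤q′ , q′≤q) (l , u) → q≤q′ ∘ l , u ∘ q′≤q)
      ( (λ v∈E → let l , u = E⊆ v∈E in real-mono-≤ l , real-mono-≤ u)
      , (λ (l , u) → ⊆E (real-cancel-≤ l , real-cancel-≤ u)))
    where
    R : Pred ℝ² 0ℓ
    R (_ , q) = real b₁ ≤ q × q ≤ real b₂

  realize-rectangle : ∀ {E} a₁ a₂ b → E ≐ (λ v → a₁ ≤ⁿ x v × x v ≤ⁿ a₂ × y v ≤ⁿ b) → Realized E
  realize-rectangle a₁ a₂ b (E⊆ , ⊆E) =
    R , inj₁ (real a₁ , real a₂ , real b , (λ r → r) , (λ r → r)) , image-∩ π R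
      (λ ((p≤p′ , p′≤p) , (_ , q′≤q)) (l , r , u) → p≤p′ ∘ l , r ∘ p′≤p , u ∘ q′≤q)
      ( (λ v∈E → let l , r , u = E⊆ v∈E in real-mono-≤ l , real-mono-≤ r , real-mono-≤ u)
      , (λ (l , r , u) → ⊆E (real-cancel-≤ l , real-cancel-≤ r , real-cancel-≤ u)))
    where
    R : Pred ℝ² 0ℓ
    R (p , q) = real a₁ ≤ p × p ≤ real a₂ × q ≤ real b

  realize-block : ∀ {j E} (S : Stage j) k → k + m ≤ⁿ size j → E ≐ Block S k → Realized E
  realize-block {j} {E} S k k+m≤ (E⊆ , ⊆E) =
    realize-strip (s + k) (s + pred (k + m)) ((λ v∈E → to (E⊆ v∈E)) , from)
    where
    s : ℕ
    s = start S * m ^ m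

    -- The level of `S` is below `m`, so `m` is positive and the block has a last position,
    -- `pred (k + m)`.
    instance
      k+m≢0 : NonZero (k + m)
      k+m≢0 = >-nonZero (ℕₚ.<-≤-trans (ℕₚ.≤-<-trans z≤n (level<m S)) (ℕₚ.m≤n+m m k))

    to : ∀ {v} → v ∈ Block S k → s + k ≤ⁿ y v × y v ≤ⁿ s + pred (k + m)
    to (block k≤i i<k+m) = ℕₚ.+-monoʳ-≤ s k≤i , ℕₚ.+-monoʳ-≤ s (ℕₚ.<⇒≤pred i<k+m)

    k<size : k < size j
    k<size = ℕₚ.<-≤-trans (ℕₚ.m<m+n k (ℕₚ.≤-<-trans z≤n (level<m S))) k+m≤

    -- These two attain the bounds of the strip, so `y-<` puts earlier stages below it and later
    -- stages above it.
    first last : Vertex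
    first = vertex S (Fin.fromℕ< k<size)
    last  = vertex S (Fin.fromℕ< (ℕₚ.<-≤-trans (ℕₚ.≤-reflexive (ℕₚ.suc-pred (k + m))) k+m≤))

    from : ∀ {v} → s + k ≤ⁿ y v × y v ≤ⁿ s + pred (k + m) → v ∈ E
    from {v} (l , u) with ℕₚ.<-cmp (start (stage v)) (start S)
    ... | tri< t<s _ _ = contradiction l (ℕₚ.<⇒≱ (subst (y v <_)
            (cong (s +_) (Finₚ.toℕ-fromℕ< _)) (y-< v first t<s)))
    ... | tri> _ _ s<t = contradiction u (ℕₚ.<⇒≱ (subst (_< y v)
            (cong (s +_) (Finₚ.toℕ-fromℕ< _)) (y-< last v s<t)))
    ... | tri≈ _ t≡s _ with start-injective {node v} {j , S} t≡s
    ...   | refl = ⊆E (block (ℕₚ.+-cancelˡ-≤ s _ _ l)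
              (ℕₚ.m≤pred[n]⇒suc[m]≤n (ℕₚ.+-cancelˡ-≤ s _ _ u)))

  realize-path : ∀ {vs E} → IsRootToLeafPath vs → E ≐ (_∈ₗ vs) → Realized E
  realize-path {v ∷ vs} (es , just root , leaf) (E⊆ , ⊆E) =
    realize-rectangle (x v) (x (endOf v vs)) (y (endOf v vs))
      -- A path vertex descends from the root and has the leaf as a descendant, so its span is
      -- nested between theirs.
      ( (λ w∈E → let v⟶*w , w⟶*l = through es (E⊆ w∈E) in
          proj₁ (span-⊑ v⟶*w) , proj₁ (span-⊑ w⟶*l) , y-mono w⟶*l)
      , (λ (≤x , x≤ , y≤) → ⊆E (on-path es root (last⇒endOf v vs leaf) ≤x x≤ y≤)))

  realize : ∀ E → E ∈ StageHyperedges ∪ PathHyperedges → Realized E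
  realize E (inj₁ (_ , S , k , k+m≤ , E≐)) = realize-block S k k+m≤ E≐
  realize E (inj₂ (_ , path , E≐))         = realize-path path E≐

theorem10 : ∀ (m : ℕ) → Realizable (ℋ m) (BottomlessRectangles ∪ HorizontalStrips)
theorem10 m = π , π-injective , realize
  where open Realization m
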